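{- Let $\mathcal{C}$ be the class of (bull, diamond)-free graphs. Let $k\ge 2$ be an integer, and let $\mathcal{F}$ be a hereditary class of graphs satisfying $\chi(F)\le k$ for every $F\in\mathcal{F}$ with $\omega(F)\le 2$. Then, for every $G\in\mathcal{C}\cap\mathcal{F}$, $\chi(G)\le\max\{k,\omega(G)\}$. Moreover, the class $\mathcal{C}$ is $2$-strongly linear-Pollyanna.
   Context: All graphs are finite and simple. $\omega(G)$ is the clique number and $\chi(G)$ the chromatic number of $G$. For graphs $H_1,\dots,H_t$, a graph $G$ is $(H_1,\dots,H_t)$-free if no induced subgraph of $G$ is isomorphic to any $H_i$. A bull is the 5-vertex graph consisting of a triangle with two disjoint pendant edges (i.e. pendant edges attached at two distinct vertices of the triangle). A diamond is the graph obtained from a path on 3 vertices by adding a new vertex adjacent to all three of its vertices (i.e. $K_4$ minus an edge). A class of graphs is hereditary if it is closed under taking induced subgraphs. A class $\mathcal{F}$ of graphs is $\chi$-bounded with binding function $f$ if $\chi(G)\le f(\omega(G))$ for all induced subgraphs $G$ of graphs in $\mathcal{F}$; it is linearly $\chi$-bounded if it has a binding function that is a linear polynomial. For a positive integer $n$, a class $\mathcal{F}$ of graphs is $n$-good if it is hereditary and there is a constant $m$ such that $\chi(G)\le m$ for every $G\in\mathcal{F}$ with $\omega(G)\le n$. A class $\mathcal{C}$ of graphs is $n$-strongly linear-Pollyanna if $\mathcal{C}\cap\mathcal{F}$ is linearly $\chi$-bounded for every $n$-good class $\mathcal{F}$ of graphs. -}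

module Defs where

open import Level using (Level; 0ℓ) renaming (suc to lsuc)
open import Data.Bool using (Bool; true; false; _∨_)
import Data.Bool.Properties as Bool
open import Data.Empty using (⊥-elim)
open import Data.Fin using (Fin; zero; suc; finToFun; funToFin)
open import Data.Fin.Patterns using (0F; 1F; 2F; 3F; 4F)
open import Data.Fin.Properties using (_≟_; any?; all?; finToFun-funToFin)
open import Data.Fin.Subset using (Subset; _∈_; ∣_∣; ⊥)
open import Data.Fin.Subset.Properties using (_∈?_; anySubset?; ∉⊥; ∣⊥∣≡0; ∣p∣≤n)
open import Data.List using (List; []; _∷_)
open import Data.List.Membership.DecPropositional using () renaming (_∈?_ to member?)
open import Data.List.Relation.Unary.All using (All)
open import Data.Nat using (ℕ; zero; suc; _+_; _*_; _≤_; z≤n; s≤s; NonZero)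
import Data.Nat.Properties as ℕ
open import Data.Product using (∃; ∃-syntax; _×_; _,_; proj₁)
import Data.Product.Properties as Product
open import Function using (_∘_; id)
open import Function.Definitions using (Injective)
open import Relation.Binary.PropositionalEquality
  using (_≡_; _≢_; refl; sym; trans; subst)
open import Relation.Nullary using (¬_; Dec; yes; no; does; ¬?)
open import Relation.Nullary.Decidable using (map′; _×-dec_; _→-dec_)
open import Relation.Unary using (Pred; Decidable; _∩_)

IsLeast IsGreatest : Pred ℕ 0ℓ → Pred ℕ 0ℓ
IsLeast    P k = P k × (∀ j → P j → k ≤ j)
IsGreatest P k = P k × (∀ j → P j → j ≤ k)

least : {P : Pred ℕ 0ℓ} → Decidable P → (n : ℕ) → P n → ∃ (IsLeast P)
least P? zero p = zero , p , λ _ _ → z≤n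
least {P} P? (suc n) p with P? zero
... | yes p₀ = zero , p₀ , λ _ _ → z≤n
... | no ¬p₀ with least (P? ∘ suc) n p
...   | k , pk , min = suc k , pk , min′
  where
  min′ : ∀ j → P j → suc k ≤ j
  min′ zero    pj = ⊥-elim (¬p₀ pj)
  min′ (suc j) pj = s≤s (min j pj)

greatest : {P : Pred ℕ 0ℓ} → Decidable P → P 0 →
           (b : ℕ) → (∀ j → P j → j ≤ b) → ∃ (IsGreatest P)
greatest P? p₀ zero    bound = zero , p₀ , bound
greatest {P} P? p₀ (suc b) bound with P? (suc b)
... | yes p = suc b , p , bound
... | no ¬p = greatest P? p₀ b λ j pj →
  ℕ.≤-pred (ℕ.≤∧≢⇒< (bound j pj) λ j≡ → ¬p (subst P j≡ pj))

record Graph : Set where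
  field
    order       : ℕ
    adj         : Fin order → Fin order → Bool
    symmetric   : ∀ u v → adj u v ≡ adj v u
    irreflexive : ∀ v → adj v v ≡ false

  Vertex : Set
  Vertex = Fin order

open Graph public

-- H ↪ G says that H is isomorphic to an induced subgraph of G, namely to the
-- one induced by the image of the injection.
record _↪_ (H G : Graph) : Set where
  field
    to        : Vertex H → Vertex G
    injective : Injective _≡_ _≡_ to
    induced   : ∀ u v → adj H u v ≡ adj G (to u) (to v)

IsColouring : (G : Graph) {k : ℕ} → (Vertex G → Fin k) → Set
IsColouring G c = ∀ u v → adj G u v ≡ true → c u ≢ c v

Colourable : Graph → Pred ℕ 0ℓ
Colourable G k = ∃[ c ] IsColouring G {k} c

colourable? : ∀ G → Decidable (Colourable G)
colourable? G k =
  map′ (λ (i , p) → finToFun i , p)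
       (λ (c , p) → funToFin c , λ u v e c≡ →
          p u v e (trans (sym (finToFun-funToFin c u))
                         (trans c≡ (finToFun-funToFin c v))))
       (any? λ i → isColouring? (finToFun i))
  where
  isColouring? : (c : Vertex G → Fin k) → Dec (IsColouring G c)
  isColouring? c = all? λ u → all? λ v →
    (adj G u v Bool.≟ true) →-dec ¬? (c u ≟ c v)

colourable-order : ∀ G → Colourable G (order G)
colourable-order G = id , distinct
  where
  distinct : IsColouring G id
  distinct u .u e refl with trans (sym e) (irreflexive G u)
  ... | ()

leastColouring : ∀ G → ∃ (IsLeast (Colourable G))
leastColouring G = least (colourable? G) (order G) (colourable-order G)

χ : Graph → ℕ
χ G = proj₁ (leastColouring G)

IsClique : (G : Graph) → Subset (order G) → Set
IsClique G S = ∀ u v → u ∈ S → v ∈ S → u ≢ v → adj G u v ≡ true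

HasClique : Graph → Pred ℕ 0ℓ
HasClique G k = ∃[ S ] (IsClique G S × ∣ S ∣ ≡ k)

hasClique? : ∀ G → Decidable (HasClique G)
hasClique? G k = anySubset? λ S →
  (all? λ u → all? λ v →
     (u ∈? S) →-dec (v ∈? S) →-dec ¬? (u ≟ v) →-dec (adj G u v Bool.≟ true))
  ×-dec (∣ S ∣ ℕ.≟ k)

greatestClique : ∀ G → ∃ (IsGreatest (HasClique G))
greatestClique G = greatest (hasClique? G)
  (⊥ , (λ _ _ u∈ → ⊥-elim (∉⊥ u∈)) , ∣⊥∣≡0 (order G))
  (order G)
  λ { _ (S , _ , refl) → ∣p∣≤n S }

ω : Graph → ℕ
ω G = proj₁ (greatestClique G)

listed : ∀ {n} → List (Fin n × Fin n) → Fin n → Fin n → Bool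
listed es u v = does (member? (Product.≡-dec _≟_ _≟_) (u , v) es)

joins : ∀ {n} → List (Fin n × Fin n) → Fin n → Fin n → Bool
joins es u v = listed es u v ∨ listed es v u

joins-symmetric : ∀ {n} (es : List (Fin n × Fin n)) u v → joins es u v ≡ joins es v u
joins-symmetric es u v = Bool.∨-comm (listed es u v) (listed es v u)

-- Triangle 0 1 2, with pendant vertices 3 at 0 and 4 at 1.
bull : Graph
bull = record
  { order       = 5
  ; adj         = joins edges
  ; symmetric   = joins-symmetric edges
  ; irreflexive = λ { 0F → refl ; 1F → refl ; 2F → refl ; 3F → refl ; 4F → refl }
  }
  where
  edges : List (Fin 5 × Fin 5)
  edges = (0F , 1F) ∷ (1F , 2F) ∷ (0F , 2F) ∷ (0F , 3F) ∷ (1F , 4F) ∷ []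

-- Path 0 - 1 - 2, with the extra vertex 3 adjacent to 0, 1 and 2.
diamond : Graph
diamond = record
  { order       = 4
  ; adj         = joins edges
  ; symmetric   = joins-symmetric edges
  ; irreflexive = λ { 0F → refl ; 1F → refl ; 2F → refl ; 3F → refl }
  }
  where
  edges : List (Fin 4 × Fin 4)
  edges = (0F , 1F) ∷ (1F , 2F) ∷ (3F , 0F) ∷ (3F , 1F) ∷ (3F , 2F) ∷ []

GraphClass : (ℓ : Level) → Set (lsuc ℓ)
GraphClass ℓ = Pred Graph ℓ

Free : List Graph → GraphClass 0ℓ
Free Hs G = All (λ H → ¬ (H ↪ G)) Hs

private variable
  ℓ ℓ′ : Level

-- As ↪ is taken up to isomorphism, a hereditary class is in particular closed
-- under isomorphism.
Hereditary : GraphClass ℓ → Set ℓ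
Hereditary F = ∀ {G H} → F G → H ↪ G → F H

IsBindingFunction : GraphClass ℓ → (ℕ → ℕ) → Set ℓ
IsBindingFunction F f = ∀ {G H} → F G → H ↪ G → χ H ≤ f (ω H)

-- Natural coefficients lose no generality: enlarging the coefficients of a
-- binding function to natural numbers yields another binding function.
IsLinearPolynomial : (ℕ → ℕ) → Set
IsLinearPolynomial f = ∃[ a ] ∃[ b ] (NonZero a × (∀ x → f x ≡ a * x + b))

LinearlyχBounded : GraphClass ℓ → Set ℓ
LinearlyχBounded F = ∃[ f ] (IsLinearPolynomial f × IsBindingFunction F f)

Good : (n : ℕ) .{{_ : NonZero n}} → GraphClass ℓ → Set ℓ
Good n F = Hereditary F × ∃[ m ] (∀ G → F G → ω G ≤ n → χ G ≤ m)

-- The level ℓ is that of the classes F quantified over.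
StronglyLinearPollyanna : (ℓ : Level) (n : ℕ) .{{_ : NonZero n}} →
                          GraphClass ℓ′ → Set (ℓ′ Level.⊔ lsuc ℓ)
StronglyLinearPollyanna ℓ n C =
  (F : GraphClass ℓ) → Good n F → LinearlyχBounded (C ∩ F)

{-# OPTIONS --safe #-}

-- Take t ≥ k, ω(G) and induct on the number of vertices; if ω(G) ≤ 2 the
-- hypothesis on F applies, so let K be a maximum clique, of size ≥ 3.
-- Diamond-freeness gives every vertex outside K at most one neighbour in K, and
-- then bull-freeness makes outside neighbours of distinct vertices of K adjacent
-- to each other.  A vertex of K with no outside neighbour has degree < t and can
-- be deleted.  If there is none, diamond-freeness forces every vertex of K to have
-- exactly one outside neighbour, and these form a clique: colour G ∖ K, and give
-- each vertex of K the colour of the outside neighbour of its cyclic predecessor.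
module Submission where

open import Defs
open import Level using (Level; 0ℓ)
open import Data.Bool using (true; false)
import Data.Bool.Properties as Bool
open import Data.Empty using (⊥-elim)
open import Data.Fin using (Fin; zero; suc; fromℕ; inject₁; inject≤; punchIn; punchOut)
import Data.Fin as Fin
open import Data.Fin.Patterns using (0F; 1F; 2F; 3F; 4F)
open import Data.Fin.Properties using (_≟_; <-cmp; any?; all?; suc-injective; injective⇒≤; ¬∀⟶∃¬; fromℕ≢inject₁; inject₁-injective; inject≤-injective; punchIn-punchOut)
open import Data.Fin.Subset using (Subset; ∣_∣; inside; outside) renaming (_∈_ to _∈ₛ_)
open import Data.Fin.Subset.Properties using (p⊂q⇒∣p∣<∣q∣; ∈⊤; ∣⊤∣≡n)
open import Data.List using ([]; _∷_)
open import Data.List.Relation.Unary.All using ([]; _∷_)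
import Data.List.Relation.Unary.All as All
open import Data.Nat using (ℕ; zero; suc; _+_; _*_; _≤_; _<_; _⊔_; s≤s)
open import Data.Nat.Induction using (Acc; acc; <-wellFounded)
import Data.Nat.Properties as ℕ
open import Data.Product using (∃-syntax; _×_; _,_; proj₁; proj₂)
open import Data.Sum using (_⊎_; inj₁; inj₂)
open import Data.Vec using (_∷_; here; there; tabulate)
open import Data.Vec.Properties using (lookup∘tabulate; lookup⇒[]=; []=⇒lookup)
open import Function using (_∘_)
open import Function.Definitions using (Injective)
open import Relation.Binary using (tri<; tri≈; tri>)
open import Relation.Binary.PropositionalEquality
open import Relation.Nullary using (¬_; Dec; yes; no; does; ¬?; contradiction)
open import Relation.Nullary.Decidable using (_×-dec_; _⊎-dec_; _→-dec_; from-yes; dec-true; decidable-stable)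
open import Relation.Unary using (Pred; Decidable; _∈_; _∩_)

open _↪_

private variable
  j m n t : ℕ
  G H     : Graph

-- Finite sets and functions between them.

comprehension : {P : Pred (Fin n) 0ℓ} → Decidable P → Subset n
comprehension P? = tabulate (does ∘ P?)

module _ {P : Pred (Fin n) 0ℓ} (P? : Decidable P) where

  ∈-comprehension⁺ : ∀ {v} → P v → v ∈ₛ comprehension P?
  ∈-comprehension⁺ {v} p =
    lookup⇒[]= v _ (trans (lookup∘tabulate (does ∘ P?) v) (dec-true (P? v) p))

  ∈-comprehension⁻ : ∀ {v} → v ∈ₛ comprehension P? → P v
  ∈-comprehension⁻ {v} v∈ with P? v | trans (sym (lookup∘tabulate (does ∘ P?) v)) ([]=⇒lookup v∈)
  ... | yes p | _ = p

-- Turns a subset into an injective family, so that cliques can be indexed and the vertices of an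
-- induced subgraph renumbered.
enumerate : (S : Subset n) → Fin ∣ S ∣ → Fin n
enumerate (inside  ∷ S) zero    = zero
enumerate (inside  ∷ S) (suc i) = suc (enumerate S i)
enumerate (outside ∷ S) i       = suc (enumerate S i)

enumerate-injective : (S : Subset n) → Injective _≡_ _≡_ (enumerate S)
enumerate-injective (inside  ∷ S) {zero}  {zero}  _  = refl
enumerate-injective (inside  ∷ S) {suc _} {suc _} eq = cong suc (enumerate-injective S (suc-injective eq))
enumerate-injective (outside ∷ S) eq                 = enumerate-injective S (suc-injective eq)

enumerate-∈ : (S : Subset n) (i : Fin ∣ S ∣) → enumerate S i ∈ₛ S
enumerate-∈ (inside  ∷ S) zero    = here
enumerate-∈ (inside  ∷ S) (suc i) = there (enumerate-∈ S i)
enumerate-∈ (outside ∷ S) i       = there (enumerate-∈ S i)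

enumerate-surjective : (S : Subset n) {v : Fin n} → v ∈ₛ S → ∃[ i ] enumerate S i ≡ v
enumerate-surjective (inside  ∷ S) here       = zero , refl
enumerate-surjective (inside  ∷ S) (there v∈) =
  let i , eq = enumerate-surjective S v∈ in suc i , cong suc eq
enumerate-surjective (outside ∷ S) (there v∈) =
  let i , eq = enumerate-surjective S v∈ in i , cong suc eq

-- If every value were attained, choosing preimages would inject `Fin t` into the smaller `Fin j`.
missedValue : j < t → (f : Fin j → Fin t) → ∃[ a ] (∀ i → f i ≢ a)
missedValue {j} {t} j<t f with any? (λ a → all? λ i → ¬? (f i ≟ a))
... | yes found = found
... | no ¬found = contradiction (injective⇒≤ preimage-injective) (ℕ.<⇒≱ j<t)
  where
  preimage : ∀ a → ∃[ i ] f i ≡ a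
  preimage a with any? (λ i → f i ≟ a)
  ... | yes p = p
  ... | no ¬p = ⊥-elim (¬found (a , λ i eq → ¬p (i , eq)))
  preimage-injective : Injective _≡_ _≡_ (proj₁ ∘ preimage)
  preimage-injective {a} {b} eq =
    trans (sym (proj₂ (preimage a))) (trans (cong f eq) (proj₂ (preimage b)))

-- Recolouring a clique calls for a permutation without fixed points; this rotation is one as soon
-- as there are two indices.
cyclicPred : Fin (suc n) → Fin (suc n)
cyclicPred {n} zero = fromℕ n
cyclicPred (suc i)  = inject₁ i

cyclicPred-injective : Injective _≡_ _≡_ (cyclicPred {n})
cyclicPred-injective {x = zero}  {zero}  _  = refl
cyclicPred-injective {x = zero}  {suc _} eq = contradiction eq fromℕ≢inject₁
cyclicPred-injective {x = suc _} {zero}  eq = contradiction (sym eq) fromℕ≢inject₁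
cyclicPred-injective {x = suc _} {suc _} eq = cong suc (inject₁-injective eq)

cyclicPred-≢ : (i : Fin (2 + n)) → cyclicPred i ≢ i
cyclicPred-≢ (suc i) eq = lemma i eq
  where
  lemma : ∀ {n} (i : Fin n) → inject₁ i ≢ suc i
  lemma (suc i) eq = lemma i (suc-injective eq)

third : (a b : Fin (3 + m)) → ∃[ c ] (c ≢ a × c ≢ b)
third zero          zero          = 1F , (λ ()) , (λ ())
third zero          (suc zero)    = 2F , (λ ()) , (λ ())
third zero          (suc (suc _)) = 1F , (λ ()) , (λ ())
third (suc zero)    zero          = 2F , (λ ()) , (λ ())
third (suc (suc _)) zero          = 1F , (λ ()) , (λ ())
third (suc _)       (suc _)       = 0F , (λ ()) , (λ ())

-- Induced subgraphs and explicit embeddings.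

↪-trans : ∀ {G H I} → G ↪ H → H ↪ I → G ↪ I
↪-trans f g = record
  { to        = to g ∘ to f
  ; injective = injective f ∘ injective g
  ; induced   = λ u v → trans (induced f u v) (induced g (to f u) (to f v))
  }

Free-hereditary : ∀ Hs → Hereditary (Free Hs)
Free-hereditary Hs free H↪G = All.map (λ ¬↪ ↪H → ¬↪ (↪-trans ↪H H↪G)) free

-- Symmetry and irreflexivity settle the remaining pairs, which halves the case analysis for an
-- explicit embedding.
induced-from-< : (f : Vertex H → Vertex G) →
                 (∀ u v → u Fin.< v → adj H u v ≡ adj G (f u) (f v)) →
                 ∀ u v → adj H u v ≡ adj G (f u) (f v)
induced-from-< {H} {G} f up u v with <-cmp u v
... | tri< u<v _ _  = up u v u<v
... | tri≈ _ refl _ = trans (irreflexive H u) (sym (irreflexive G (f u)))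
... | tri> _ _ v<u  = trans (symmetric H u v) (trans (up v u v<u) (symmetric G (f v) (f u)))

Twins : (H : Graph) → Vertex H → Vertex H → Set
Twins H u v = ∀ w → adj H u w ≡ adj H v w

twins? : (H : Graph) (u v : Vertex H) → Dec (Twins H u v)
twins? H u v = all? λ w → adj H u w Bool.≟ adj H v w

-- A map preserving adjacency and non-adjacency can merge only vertices with the same neighbours, so
-- its injectivity reduces to finding the twins of the pattern `H`.
image-≡⇒twins : (f : Vertex H → Vertex G) → (∀ u v → adj H u v ≡ adj G (f u) (f v)) →
                ∀ {u v} → f u ≡ f v → Twins H u v
image-≡⇒twins {G = G} f ind {u} {v} eq w =
  trans (ind u w) (trans (cong (λ x → adj G x (f w)) eq) (sym (ind v w)))

-- Checked on all pairs. Every map out of the bull that preserves adjacency and non-adjacency is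
-- therefore injective.
bull-twins : ∀ u v → Twins bull u v → u ≡ v
bull-twins = from-yes (all? λ u → all? λ v → twins? bull u v →-dec (u ≟ v))

-- The ends of the path are the only twins, so distinctness has to be assumed of their images alone.
diamond-twins : ∀ u v → Twins diamond u v → u ≡ v ⊎ (u ≡ 0F × v ≡ 2F) ⊎ (u ≡ 2F × v ≡ 0F)
diamond-twins = from-yes (all? λ u → all? λ v → twins? diamond u v →-dec
  ((u ≟ v) ⊎-dec ((u ≟ 0F) ×-dec (v ≟ 2F)) ⊎-dec ((u ≟ 2F) ×-dec (v ≟ 0F))))

-- Cliques, colourings and vertex deletion in a fixed graph.

module Adjacency (G : Graph) where

  infix 4 _~_ _≁_

  _~_ _≁_ : Vertex G → Vertex G → Set
  u ~ v = adj G u v ≡ true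
  u ≁ v = adj G u v ≡ false

  ~-sym : ∀ {u v} → u ~ v → v ~ u
  ~-sym {u} {v} = trans (symmetric G v u)

  ~⇒≢ : ∀ {u v} → u ~ v → u ≢ v
  ~⇒≢ {u} u~u refl with trans (sym u~u) (irreflexive G u)
  ... | ()

  ¬~⇒≁ : ∀ {u v} → ¬ (u ~ v) → u ≁ v
  ¬~⇒≁ = Bool.¬-not

  ~-dec : ∀ u v → Dec (u ~ v)
  ~-dec u v = adj G u v Bool.≟ true

  PairwiseAdjacent : (Fin j → Vertex G) → Set
  PairwiseAdjacent K = ∀ {a b} → a ≢ b → K a ~ K b

  pairwiseAdjacent⇒injective : {K : Fin j → Vertex G} → PairwiseAdjacent K → Injective _≡_ _≡_ K
  pairwiseAdjacent⇒injective adjacent {a} {b} eq =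
    decidable-stable (a ≟ b) λ a≢b → ~⇒≢ (adjacent a≢b) eq

  -- Deleted vertices are given as a family `W`, so that one vertex and a whole clique are treated
  -- alike.
  Avoids : (Fin j → Vertex G) → Pred (Vertex G) 0ℓ
  Avoids W v = ∀ i → v ≢ W i

  avoids? : (W : Fin j → Vertex G) → Decidable (Avoids W)
  avoids? W v = all? λ i → ¬? (v ≟ W i)

  ¬avoids⇒hit : (W : Fin j → Vertex G) → ∀ {v} → ¬ Avoids W v → ∃[ i ] v ≡ W i
  ¬avoids⇒hit {j} W {v} ¬av =
    let i , ¬≢ = ¬∀⟶∃¬ j _ (λ i → ¬? (v ≟ W i)) ¬av in i , decidable-stable (v ≟ W i) ¬≢

  -- `ω` speaks of subsets: the image of `K` is a clique in that sense, and locating each `K i` in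
  -- its enumeration injects `Fin j` into it.
  pairwiseAdjacent⇒≤ω : {K : Fin j → Vertex G} → PairwiseAdjacent K → j ≤ ω G
  pairwiseAdjacent⇒≤ω {j} {K} adjacent = ℕ.≤-trans (injective⇒≤ position-injective)
    (proj₂ (proj₂ (greatestClique G)) ∣ image ∣ (image , image-clique , refl))
    where
    hit? : Decidable (λ v → ∃[ i ] K i ≡ v)
    hit? v = any? λ i → K i ≟ v
    image : Subset (order G)
    image = comprehension hit?
    image-clique : IsClique G image
    image-clique u v u∈ v∈ u≢v
      with ∈-comprehension⁻ hit? u∈ | ∈-comprehension⁻ hit? v∈
    ... | a , refl | b , refl = adjacent λ a≡b → u≢v (cong K a≡b)
    position : ∀ i → ∃[ p ] enumerate image p ≡ K i
    position i = enumerate-surjective image (∈-comprehension⁺ hit? (i , refl))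
    position-injective : Injective _≡_ _≡_ (proj₁ ∘ position)
    position-injective {a} {b} eq = pairwiseAdjacent⇒injective adjacent
      (trans (sym (proj₂ (position a))) (trans (cong (enumerate image) eq) (proj₂ (position b))))

  hasClique⇒pairwiseAdjacent : HasClique G j → ∃[ K ] PairwiseAdjacent {j} K
  hasClique⇒pairwiseAdjacent (S , clique , refl) = enumerate S , λ a≢b →
    clique _ _ (enumerate-∈ S _) (enumerate-∈ S _) (a≢b ∘ enumerate-injective S)

  ProperOn : Pred (Vertex G) 0ℓ → (Vertex G → Fin t) → Set
  ProperOn P c = ∀ {u v} → P u → P v → u ~ v → c u ≢ c v

  -- `d` overrides `c` on the deleted vertices; the three hypotheses cover edges among the kept
  -- vertices, among the deleted ones, and between the two.
  colourable-extend : (W : Fin j → Vertex G) (d : Fin j → Fin t) (c : Vertex G → Fin t) →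
    ProperOn (Avoids W) c →
    (∀ {a b} → W a ~ W b → d a ≢ d b) →
    (∀ {a v} → Avoids W v → W a ~ v → d a ≢ c v) →
    Colourable G t
  colourable-extend {t = t} W d c proper within across = colour , isColouring
    where
    colour : Vertex G → Fin t
    colour v with avoids? W v
    ... | yes _  = c v
    ... | no ¬av = d (proj₁ (¬avoids⇒hit W ¬av))
    isColouring : IsColouring G colour
    isColouring u v u~v with avoids? W u | avoids? W v
    ... | yes au | yes av = proper au av u~v
    ... | yes au | no ¬av = let _ , v≡ = ¬avoids⇒hit W ¬av in
      across au (subst (_~ u) v≡ (~-sym u~v)) ∘ sym
    ... | no ¬au | yes av = let _ , u≡ = ¬avoids⇒hit W ¬au in
      across av (subst (_~ v) u≡ u~v)
    ... | no ¬au | no ¬av = let _ , u≡ = ¬avoids⇒hit W ¬au ; _ , v≡ = ¬avoids⇒hit W ¬av in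
      within (subst₂ _~_ u≡ v≡ u~v)

  survivors : (Fin j → Vertex G) → Subset (order G)
  survivors W = comprehension (avoids? W)

  delete : (Fin j → Vertex G) → Graph
  delete W = record
    { order       = ∣ survivors W ∣
    ; adj         = λ u v → adj G (enumerate (survivors W) u) (enumerate (survivors W) v)
    ; symmetric   = λ u v → symmetric G _ _
    ; irreflexive = λ v → irreflexive G _
    }

  delete-↪ : (W : Fin j → Vertex G) → delete W ↪ G
  delete-↪ W = record
    { to        = enumerate (survivors W)
    ; injective = enumerate-injective (survivors W)
    ; induced   = λ _ _ → refl
    }

  -- `W zero` is a vertex certain to be lost. The strict decrease drives the induction on the order.
  order-delete-< : (W : Fin (suc j) → Vertex G) → order (delete W) < order G
  order-delete-< W = subst (∣ survivors W ∣ <_) (∣⊤∣≡n (order G))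
    (p⊂q⇒∣p∣<∣q∣ ((λ _ → ∈⊤) , W zero , ∈⊤ , λ W₀∈ → ∈-comprehension⁻ (avoids? W) W₀∈ zero refl))

  -- The colours that c gives to the deleted vertices are arbitrary.
  delete-colouring : (W : Fin j → Vertex G) → Fin t → Colourable (delete W) t →
                     ∃[ c ] ProperOn {t} (Avoids W) c
  delete-colouring {t = t} W default (c′ , isColouring) = c , proper
    where
    index : ∀ {v} → Avoids W v → ∃[ i ] enumerate (survivors W) i ≡ v
    index av = enumerate-surjective (survivors W) (∈-comprehension⁺ (avoids? W) av)
    c : Vertex G → Fin t
    c v with avoids? W v
    ... | yes av = c′ (proj₁ (index av))
    ... | no _   = default
    proper : ProperOn (Avoids W) c
    proper {u} {v} au av u~v with avoids? W u | avoids? W v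
    ... | yes au′ | yes av′ = isColouring _ _
      (subst₂ _~_ (sym (proj₂ (index au′))) (sym (proj₂ (index av′))) u~v)
    ... | no ¬au  | _       = contradiction au ¬au
    ... | yes _   | no ¬av  = contradiction av ¬av

  module _ (diamondFree : ¬ (diamond ↪ G)) where

    -- If `a` and `b` were non-adjacent, the induced path `a`, `p`, `b` together with `q` would be a
    -- diamond.
    commonNeighbours-adjacent : ∀ {a b p q} → p ~ q → p ~ a → q ~ a → p ~ b → q ~ b → a ≢ b → a ~ b
    commonNeighbours-adjacent {a} {b} {p} {q} p~q p~a q~a p~b q~b a≢b =
      decidable-stable (~-dec a b) λ ¬a~b → diamondFree (embedding (¬~⇒≁ ¬a~b))
      where
      f : Vertex diamond → Vertex G
      f 0F = a
      f 1F = p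
      f 2F = b
      f 3F = q
      embedding : a ≁ b → diamond ↪ G
      embedding a≁b = record { to = f ; injective = inj ; induced = ind }
        where
        up : ∀ u v → u Fin.< v → adj diamond u v ≡ adj G (f u) (f v)
        up 0F 1F _ = sym (~-sym p~a)
        up 0F 2F _ = sym a≁b
        up 0F 3F _ = sym (~-sym q~a)
        up 1F 2F _ = sym p~b
        up 1F 3F _ = sym p~q
        up 2F 3F _ = sym (~-sym q~b)
        up _ 0F ()
        up (suc _) 1F (s≤s ())
        up (suc (suc _)) 2F (s≤s (s≤s ()))
        up 3F 3F (s≤s (s≤s (s≤s ())))
        ind : ∀ u v → adj diamond u v ≡ adj G (f u) (f v)
        ind = induced-from-< {diamond} {G} f up
        inj : Injective _≡_ _≡_ f
        inj {u} {v} eq with diamond-twins u v (image-≡⇒twins {diamond} {G} f ind eq)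
        ... | inj₁ u≡v                  = u≡v
        ... | inj₂ (inj₁ (refl , refl)) = contradiction eq a≢b
        ... | inj₂ (inj₂ (refl , refl)) = contradiction (sym eq) a≢b

  module _ (bullFree : ¬ (bull ↪ G)) where

    -- Otherwise the triangle `a`, `b`, `c` with pendants `v` at `a` and `w` at `b` would be an
    -- induced bull.
    pendants-adjacent : ∀ {a b c v w} → a ~ b → b ~ c → a ~ c →
                        a ~ v → b ≁ v → c ≁ v → b ~ w → a ≁ w → c ≁ w → v ~ w
    pendants-adjacent {a} {b} {c} {v} {w} a~b b~c a~c a~v b≁v c≁v b~w a≁w c≁w =
      decidable-stable (~-dec v w) λ ¬v~w → bullFree (embedding (¬~⇒≁ ¬v~w))
      where
      f : Vertex bull → Vertex G
      f 0F = a
      f 1F = b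
      f 2F = c
      f 3F = v
      f 4F = w
      embedding : v ≁ w → bull ↪ G
      embedding v≁w = record
        { to        = f
        ; injective = λ {x} {y} eq → bull-twins x y (image-≡⇒twins {bull} {G} f ind eq)
        ; induced   = ind
        }
        where
        up : ∀ x y → x Fin.< y → adj bull x y ≡ adj G (f x) (f y)
        up 0F 1F _ = sym a~b
        up 0F 2F _ = sym a~c
        up 0F 3F _ = sym a~v
        up 0F 4F _ = sym a≁w
        up 1F 2F _ = sym b~c
        up 1F 3F _ = sym b≁v
        up 1F 4F _ = sym b~w
        up 2F 3F _ = sym c≁v
        up 2F 4F _ = sym c≁w
        up 3F 4F _ = sym v≁w
        up _ 0F ()
        up (suc _) 1F (s≤s ())
        up (suc (suc _)) 2F (s≤s (s≤s ()))
        up (suc (suc (suc _))) 3F (s≤s (s≤s (s≤s ())))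
        up 4F 4F (s≤s (s≤s (s≤s (s≤s ()))))
        ind : ∀ x y → adj bull x y ≡ adj G (f x) (f y)
        ind = induced-from-< {bull} {G} f up

-- Neighbours of a maximum clique with at least three vertices.

module MaximumClique
  (G : Graph) (bullFree : ¬ (bull ↪ G)) (diamondFree : ¬ (diamond ↪ G))
  {m : ℕ} (K : Fin (3 + m) → Vertex G)
  (K-adjacent : Adjacency.PairwiseAdjacent G K) (ω≤ : ω G ≤ 3 + m) where

  open Adjacency G

  Outside : Pred (Vertex G) 0ℓ
  Outside = Avoids K

  ¬complete : ∀ {v} → ¬ (∀ i → K i ~ v)
  ¬complete {v} complete = ℕ.<⇒≱ (pairwiseAdjacent⇒≤ω {K = K⁺} K⁺-adjacent) ω≤
    where
    K⁺ : Fin (4 + m) → Vertex G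
    K⁺ zero    = v
    K⁺ (suc i) = K i
    K⁺-adjacent : PairwiseAdjacent K⁺
    K⁺-adjacent {zero}  {zero}  ≢ = contradiction refl ≢
    K⁺-adjacent {zero}  {suc i} _ = ~-sym (complete i)
    K⁺-adjacent {suc i} {zero}  _ = complete i
    K⁺-adjacent {suc i} {suc l} ≢ = K-adjacent (≢ ∘ cong suc)

  -- If `v` were adjacent to both `K a` and `K b`, diamond-freeness would join it to every other
  -- `K i` as well, contradicting the maximality of `K`.
  neighbour-unique : ∀ {a b v} → Outside v → a ≢ b → K a ~ v → ¬ (K b ~ v)
  neighbour-unique {a} {b} {v} out a≢b a~v b~v = ¬complete complete
    where
    complete : ∀ i → K i ~ v
    complete i with i ≟ a | i ≟ b
    ... | yes refl | _        = a~v
    ... | no _     | yes refl = b~v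
    ... | no i≢a   | no i≢b   = commonNeighbours-adjacent diamondFree
      (K-adjacent a≢b) (K-adjacent (i≢a ∘ sym)) (K-adjacent (i≢b ∘ sym)) a~v b~v (out i ∘ sym)

  -- A third clique vertex `K c` completes a triangle. By `neighbour-unique`, `v` and `w` are
  -- pendant to it at `K a` and `K b`, so bull-freeness joins them.
  neighbours-adjacent : ∀ {a b v w} → a ≢ b → Outside v → Outside w → K a ~ v → K b ~ w → v ~ w
  neighbours-adjacent {a} {b} a≢b out-v out-w a~v b~w =
    let c , c≢a , c≢b = third a b in
    pendants-adjacent bullFree
      (K-adjacent a≢b) (K-adjacent (c≢b ∘ sym)) (K-adjacent (c≢a ∘ sym))
      a~v (¬~⇒≁ (neighbour-unique out-v a≢b a~v)) (¬~⇒≁ (neighbour-unique out-v (c≢a ∘ sym) a~v))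
      b~w (¬~⇒≁ (neighbour-unique out-w (a≢b ∘ sym) b~w)) (¬~⇒≁ (neighbour-unique out-w (c≢b ∘ sym) b~w))

  -- All neighbours of `K a` lie in `K`, so they occupy at most `2 + m` colours and one of the `t`
  -- is left for `K a`.
  colourable-isolated : 3 + m ≤ t → ∀ a → (∀ v → Outside v → ¬ (K a ~ v)) →
                        (c : Vertex G → Fin t) → ProperOn (Avoids {1} λ _ → K a) c → Colourable G t
  colourable-isolated {t} 3+m≤t a isolated c proper =
    colourable-extend W (λ _ → new) c proper
      (λ K~K → contradiction refl (~⇒≢ K~K)) λ {i} → across {i}
    where
    W : Fin 1 → Vertex G
    W _ = K a
    missed : ∃[ colour ] (∀ i → c (K (punchIn a i)) ≢ colour)
    -- `punchIn a` runs over the `2 + m` other clique vertices; `3 + m ≤ t` is by definition the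
    -- required `2 + m < t`.
    missed = missedValue 3+m≤t (c ∘ K ∘ punchIn a)
    new : Fin t
    new = proj₁ missed
    across : ∀ {i v} → Avoids W v → W i ~ v → new ≢ c v
    across {v = v} av a~v new≡ with avoids? K v
    ... | yes out = isolated v out a~v
    ... | no ¬out with ¬avoids⇒hit K ¬out
    ...   | b , refl = proj₂ missed (punchOut a≢b)
            (trans (cong (c ∘ K) (punchIn-punchOut a≢b)) (sym new≡))
      where
      a≢b : a ≢ b
      a≢b a≡b = av zero (cong K (sym a≡b))

  module _ (x : Fin (3 + m) → Vertex G)
           (x-outside : ∀ i → Outside (x i)) (x-adjacent : ∀ i → K i ~ x i) where

    -- Take distinct indices `a`, `b`, `c` and suppose `v ≢ x a`. The adjacent pair `x b`, `x c` is
    -- joined to both `v` and `x a`, so `v ~ x a`. Then the pair `v`, `x a` is joined to both `K a`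
    -- and `x b`, so `K a ~ x b`, giving `x b` two neighbours in `K`.
    outsideNeighbour-≡ : ∀ {a v} → Outside v → K a ~ v → v ≡ x a
    outsideNeighbour-≡ {a} {v} out a~v with third a a
    ... | b , b≢a , _ with third a b
    ...   | c , c≢a , c≢b = decidable-stable (v ≟ x a) λ v≢x →
      neighbour-unique (x-outside b) b≢a (x-adjacent b) (Ka~xb (v~xa v≢x))
      where
      across : ∀ {i w} → i ≢ a → Outside w → K a ~ w → x i ~ w
      across i≢a out-w a~w = neighbours-adjacent i≢a (x-outside _) out-w (x-adjacent _) a~w
      xb~xa : x b ~ x a
      xb~xa = across b≢a (x-outside a) (x-adjacent a)
      xc~xa : x c ~ x a
      xc~xa = across c≢a (x-outside a) (x-adjacent a)
      v~xa : v ≢ x a → v ~ x a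
      v~xa = commonNeighbours-adjacent diamondFree
        (neighbours-adjacent (c≢b ∘ sym) (x-outside b) (x-outside c) (x-adjacent b) (x-adjacent c))
        (across b≢a out a~v) (across c≢a out a~v) xb~xa xc~xa
      Ka~xb : v ~ x a → K a ~ x b
      Ka~xb v~x = commonNeighbours-adjacent diamondFree v~x
        (~-sym a~v) (~-sym (x-adjacent a)) (~-sym (across b≢a out a~v)) (~-sym xb~xa)
        (x-outside b a ∘ sym)

    -- The `x i` form a clique, so their colours differ, also after the rotation. As `x a` is the
    -- only outside neighbour of `K a`, it suffices that `cyclicPred` fixes no index.
    colourable-matched : (c : Vertex G → Fin t) → ProperOn Outside c → Colourable G t
    colourable-matched c proper = colourable-extend K (c ∘ x ∘ cyclicPred) c proper within across
      where
      distinct : ∀ {a b} → a ≢ b → c (x a) ≢ c (x b)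
      distinct a≢b = proper (x-outside _) (x-outside _)
        (neighbours-adjacent a≢b (x-outside _) (x-outside _) (x-adjacent _) (x-adjacent _))
      within : ∀ {a b} → K a ~ K b → c (x (cyclicPred a)) ≢ c (x (cyclicPred b))
      within {a} {b} a~b = distinct λ eq → ~⇒≢ a~b (cong K (cyclicPred-injective eq))
      across : ∀ {a v} → Outside v → K a ~ v → c (x (cyclicPred a)) ≢ c v
      across {a} out a~v eq = distinct (cyclicPred-≢ a) (trans eq (cong c (outsideNeighbour-≡ out a~v)))

-- Induction on the number of vertices, and the resulting bounds.

ω-mono : H ↪ G → ω H ≤ ω G
ω-mono {H} {G} H↪G =
  let K , adjacent = Adjacency.hasClique⇒pairwiseAdjacent H (proj₁ (proj₂ (greatestClique H))) in
  Adjacency.pairwiseAdjacent⇒≤ω G λ a≢b → trans (sym (induced H↪G _ _)) (adjacent a≢b)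

colourable-mono : ∀ {s} → s ≤ t → Colourable G s → Colourable G t
colourable-mono s≤t (c , isColouring) =
  (λ v → inject≤ (c v) s≤t) ,
  λ u v u~v → isColouring u v u~v ∘ inject≤-injective s≤t s≤t _ _

χ-least : ∀ G → Colourable G t → χ G ≤ t
χ-least G = proj₂ (proj₂ (leastColouring G)) _

module _ {ℓ : Level} (k : ℕ) (F : GraphClass ℓ) (hereditary : Hereditary F)
         (base : ∀ H → H ∈ F → ω H ≤ 2 → χ H ≤ k) where

  -- Deletion may lower the clique number, so `t` is kept arbitrary above `k` and `ω G`: the same
  -- `t` then passes to the smaller graph.
  colourable : k ≤ t → ∀ G → Acc _<_ (order G) → G ∈ F → G ∈ Free (bull ∷ diamond ∷ []) →
               ω G ≤ t → Colourable G t
  colourable {t} k≤t G (acc rec) G∈F free@(bullFree ∷ diamondFree ∷ []) ω≤t with ω G ℕ.≤? 2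
  ... | yes ω≤2 = colourable-mono {G = G} (ℕ.≤-trans (base G G∈F ω≤2) k≤t) (proj₁ (proj₂ (leastColouring G)))
  ... | no ω≰2 with ℕ.m≤n⇒∃[o]m+o≡n (ℕ.≰⇒> ω≰2)
  ...   | m , 3+m≡ω = go (any? λ a → all? λ v → avoids? K v →-dec ¬? (~-dec (K a) v))
    where
    open Adjacency G
    clique = hasClique⇒pairwiseAdjacent (subst (HasClique G) (sym 3+m≡ω) (proj₁ (proj₂ (greatestClique G))))
    K = proj₁ clique
    open MaximumClique G bullFree diamondFree K (proj₂ clique) (ℕ.≤-reflexive (sym 3+m≡ω))
    3+m≤t : 3 + m ≤ t
    3+m≤t = subst (_≤ t) (sym 3+m≡ω) ω≤t
    smaller : (W : Fin (suc j) → Vertex G) → ∃[ c ] ProperOn {t} (Avoids W) c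
    -- `3 + m ≤ t` guarantees that a colour exists to serve as the default.
    smaller W = delete-colouring W (inject≤ zero 3+m≤t) (colourable k≤t (delete W) (rec (order-delete-< W))
      (hereditary G∈F (delete-↪ W)) (Free-hereditary _ free (delete-↪ W))
      (ℕ.≤-trans (ω-mono (delete-↪ W)) ω≤t))
    go : Dec (∃[ a ] (∀ v → Outside v → ¬ (K a ~ v))) → Colourable G t
    go (yes (a , isolated)) = let c , proper = smaller {0} (λ _ → K a) in colourable-isolated 3+m≤t a isolated c proper
    go (no ¬isolated) = let c , proper = smaller K in
      colourable-matched (proj₁ ∘ neighbour)
        (proj₁ ∘ proj₂ ∘ neighbour) (proj₂ ∘ proj₂ ∘ neighbour) c proper
      where
      neighbour : ∀ a → ∃[ v ] (Outside v × K a ~ v)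
      -- `¬isolated` yields only a double negation; decidable search over the finitely many vertices
      -- extracts the neighbour.
      neighbour a = decidable-stable (any? λ v → avoids? K v ×-dec ~-dec (K a) v)
        λ none → ¬isolated (a , λ v out a~v → none (v , out , a~v))

  χ≤k⊔ω : ∀ G → G ∈ Free (bull ∷ diamond ∷ []) ∩ F → χ G ≤ k ⊔ ω G
  χ≤k⊔ω G (free , G∈F) = χ-least G
    (colourable (ℕ.m≤m⊔n k (ω G)) G (<-wellFounded (order G)) G∈F free (ℕ.m≤n⊔m k (ω G)))

theorem3p1 : (ℓ : Level) →
    let C = Free (bull ∷ diamond ∷ []) in
    ((k : ℕ) → 2 ≤ k →
    (F : GraphClass ℓ) → Hereditary F →
    (∀ H → H ∈ F → ω H ≤ 2 → χ H ≤ k) →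
    ∀ G → G ∈ C ∩ F → χ G ≤ k ⊔ ω G)
    × StronglyLinearPollyanna ℓ 2 C
theorem3p1 ℓ = (λ k _ F → χ≤k⊔ω k F) , pollyanna
  where
  pollyanna : StronglyLinearPollyanna ℓ 2 (Free (bull ∷ diamond ∷ []))
  pollyanna F (hereditary , k , base) =
    -- The constant from 2-goodness serves as `k`; a maximum is at most the sum, whence slope 1 and
    -- intercept `k`.
    (λ x → 1 * x + k) , (1 , k , _ , λ _ → refl) , binding
    where
    binding : IsBindingFunction (Free (bull ∷ diamond ∷ []) ∩ F) (λ x → 1 * x + k)
    binding {H = H} (free , G∈F) H↪G =
      -- A binding function must also bound induced subgraphs; both classes being hereditary, `H`
      -- itself lies in the intersection.
      ℕ.≤-trans (χ≤k⊔ω k F hereditary base H (Free-hereditary (bull ∷ diamond ∷ []) free H↪G , hereditary G∈F H↪G))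
        (ℕ.≤-trans (ℕ.m⊔n≤m+n k (ω H))
          (ℕ.≤-reflexive (trans (ℕ.+-comm k (ω H)) (cong (_+ k) (sym (ℕ.*-identityˡ (ω H)))))))
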